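{- An interval order is better-quasi-ordered if and only if it is well-quasi-ordered.
   Context: A poset $P$ is an interval order if it is isomorphic to a set of nonempty intervals of some chain $C$, ordered by $I<J$ iff $x<y$ for every $x\in I$ and every $y\in J$. A quasi-ordered set is well-quasi-ordered (wqo) if it is well-founded and has no infinite antichain. Barriers and bqo: finite subsets of $\mathbb{N}$ are identified with their increasing enumerations. For finite $s,t\subseteq\mathbb{N}$ write $s\triangleleft t$ if there is a finite $r\subseteq\mathbb{N}$ such that $s$ is a proper initial segment of $r$ and $t$ is $r$ with its least element removed. A barrier is an infinite set $B$ of finite subsets of $\mathbb{N}$, no member of which is a proper subset of another, such that every infinite $X\subseteq\bigcup B$ has a nonempty initial segment belonging to $B$. A barrier is well-ordered by the lexicographic order; its order type is the type of this well-order. A map $f$ from a barrier $B$ into a quasi-ordered set $Q$ is good if there exist $s,t\in B$ with $s\triangleleft t$ and $f(s)\leq f(t)$, and bad otherwise. For a countable ordinal $\alpha$, $Q$ is $\alpha$-bqo if every map from a barrier of order type at most $\alpha$ into $Q$ is good; $Q$ is better-quasi-ordered (bqo) if it is $\alpha$-bqo for every countable ordinal $\alpha$. -}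

module Defs where

open import Data.List.Base using (List; []; _∷_; _++_)
import Data.List.Membership.Setoid as SetoidMembership
open import Data.List.Membership.Propositional using (_∈_)
open import Data.List.Relation.Binary.Lex.Strict using (Lex-<)
open import Data.List.Relation.Binary.Subset.Propositional using (_⊆_)
open import Data.List.Relation.Unary.Linked using (Linked)
open import Data.Nat.Base as ℕ using (ℕ)
open import Data.Product.Base using (Σ; Σ-syntax; ∃; ∃-syntax; _×_; _,_; proj₁)
open import Function.Bundles using (Func; Injection; _⟨$⟩_)
open import Induction.WellFounded using (WellFounded)
open import Level using (Level; 0ℓ; suc; _⊔_)
open import Relation.Binary.Bundles
  using (Setoid; Preorder; Poset; TotalOrder; StrictTotalOrder)
open import Relation.Binary.Core using (Rel)
import Relation.Binary.Construct.On as On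
open import Relation.Binary.Morphism.Structures
  using (IsOrderMonomorphism; IsOrderIsomorphism)
import Relation.Binary.Properties.Poset as PosetProperties
import Relation.Binary.Properties.TotalOrder as TotalOrderProperties
open import Relation.Binary.PropositionalEquality using (_≡_; _≢_; setoid)
open import Relation.Nullary.Negation using (¬_)
open import Relation.Unary using (Pred; _≐_)

private
  variable
    c ℓ ℓ₁ ℓ₂ : Level

-- A subset is finite when some list exhausts it up to the setoid equality.
Infinite : (S : Setoid c ℓ₁) → Pred (Setoid.Carrier S) ℓ → Set (c ⊔ ℓ₁ ⊔ ℓ)
Infinite S A = ¬ (∃[ xs ] (∀ x → A x → x ∈ₛ xs))
  where open SetoidMembership S renaming (_∈_ to _∈ₛ_)

------------------------------------------------------------------------
-- Interval orders

module _ {κ : Level} (C : TotalOrder κ κ κ) where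
  open TotalOrder C using (Carrier; _≤_)
  open TotalOrderProperties C using (_<_)

  -- `_<_` is the strict part of `_≤_`.  Closure of `points` under the
  -- equality of C follows from `convex`.
  record NonemptyInterval : Set (suc κ) where
    field
      points   : Pred Carrier κ
      nonempty : ∃ points
      convex   : ∀ {x y z} → points x → points z → x ≤ y → y ≤ z → points y

  open NonemptyInterval

  _≈ᴵ_ : Rel NonemptyInterval κ
  I ≈ᴵ J = points I ≐ points J

  _<ᴵ_ : Rel NonemptyInterval κ
  I <ᴵ J = ∀ {x y} → points I x → points J y → x < y

-- The isomorphism is one of strict orders, P carrying the strict part of
-- its order, and sends P onto the set `intervals`.  The universe κ of the
-- chain is a parameter, independent of the universes of P.
record IsIntervalOrder (κ : Level) (P : Poset c ℓ₁ ℓ₂)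
       : Set (c ⊔ ℓ₁ ⊔ ℓ₂ ⊔ suc κ) where
  open Poset P using (Carrier; _≈_)
  open PosetProperties P using (_<_)
  field
    chain     : TotalOrder κ κ κ
    intervals : Pred (NonemptyInterval chain) κ

  Member : Set (suc κ)
  Member = ∃ intervals

  field
    rep   : Carrier → Member
    isIso : IsOrderIsomorphism
              _≈_ (λ I J → _≈ᴵ_ chain (proj₁ I) (proj₁ J))
              _<_ (λ I J → _<ᴵ_ chain (proj₁ I) (proj₁ J))
              rep

------------------------------------------------------------------------
-- Well-quasi-orders

module _ (Q : Preorder c ℓ₁ ℓ₂) where
  open Preorder Q using (Carrier; _≈_; _≲_; module Eq)

  _⋦_ : Rel Carrier ℓ₂
  x ⋦ y = x ≲ y × ¬ (y ≲ x)

  Antichain : Pred Carrier ℓ → Set (c ⊔ ℓ₁ ⊔ ℓ₂ ⊔ ℓ)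
  Antichain A = ∀ {x y} → A x → A y → ¬ (x ≈ y) → ¬ (x ≲ y)

  WQO : Set (suc (c ⊔ ℓ₁ ⊔ ℓ₂))
  WQO = WellFounded _⋦_
      × ¬ (Σ[ A ∈ Pred Carrier (c ⊔ ℓ₁ ⊔ ℓ₂) ]
             Antichain A × Infinite Eq.setoid A)

------------------------------------------------------------------------
-- Barriers

-- A finite subset of ℕ is represented by its increasing enumeration.
Increasing : Pred (List ℕ) 0ℓ
Increasing = Linked ℕ._<_

_⊂_ : Rel (List ℕ) 0ℓ
s ⊂ t = s ⊆ t × ¬ (t ⊆ s)

ProperInitialSegment : Rel (List ℕ) 0ℓ
ProperInitialSegment s r = ∃[ x ] ∃[ u ] r ≡ s ++ x ∷ u

-- The least element of an increasing list is its head.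
_◁_ : Rel (List ℕ) 0ℓ
s ◁ t = ∃[ r ] Increasing r × ProperInitialSegment s r × ∃[ m ] r ≡ m ∷ t

InitialSegmentOf : Pred ℕ 0ℓ → Pred (List ℕ) 0ℓ
InitialSegmentOf X s =
    Increasing s
  × (∀ {n} → n ∈ s → X n)
  × (∀ {m n} → X m → n ∈ s → m ℕ.< n → m ∈ s)

record IsBarrier (B : Pred (List ℕ) 0ℓ) : Set₁ where
  field
    increasing : ∀ {s} → B s → Increasing s
    infinite   : Infinite (setoid (List ℕ)) B
    antichain  : ∀ {s t} → B s → B t → ¬ (s ⊂ t)
    blocks     : (X : Pred ℕ 0ℓ) → Infinite (setoid ℕ) X →
                 (∀ {n} → X n → ∃[ s ] B s × n ∈ s) →
                 ∃[ s ] B s × s ≢ [] × InitialSegmentOf X s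

-- The set B as a setoid: membership proofs are disregarded.
members : Pred (List ℕ) 0ℓ → Setoid 0ℓ 0ℓ
members B = On.setoid {B = ∃ B} (setoid (List ℕ)) proj₁

_<lex_ : Rel (List ℕ) 0ℓ
_<lex_ = Lex-< _≡_ ℕ._<_

------------------------------------------------------------------------
-- Countable ordinals and order types

-- A countable ordinal is given by a well-ordered countable set having that
-- order type.
record CountableOrdinal : Set₁ where
  field
    order       : StrictTotalOrder 0ℓ 0ℓ 0ℓ
    wellFounded : WellFounded (StrictTotalOrder._<_ order)
    countable   : Injection (StrictTotalOrder.Eq.setoid order) (setoid ℕ)
  open StrictTotalOrder order public using (Carrier; _≈_; _<_)

-- (B , <lex) is isomorphic to an initial segment of α.
record OrderType≤ (B : Pred (List ℕ) 0ℓ) (α : CountableOrdinal) : Set where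
  open CountableOrdinal α using (Carrier; _≈_; _<_)
  field
    embed          : ∃ B → Carrier
    isMono         : IsOrderMonomorphism
                       (Setoid._≈_ (members B)) _≈_
                       (λ s t → proj₁ s <lex proj₁ t) _<_
                       embed
    initialSegment : ∀ {s a} → a < embed s → ∃[ t ] embed t ≈ a

------------------------------------------------------------------------
-- Better-quasi-orders

module _ (Q : Preorder c ℓ₁ ℓ₂) where
  open Preorder Q using (_≲_; module Eq)

  Good : {B : Pred (List ℕ) 0ℓ} → Func (members B) Eq.setoid → Set ℓ₂
  Good {B} f = Σ[ s ∈ ∃ B ] Σ[ t ∈ ∃ B ]
                 proj₁ s ◁ proj₁ t × (f ⟨$⟩ s) ≲ (f ⟨$⟩ t)

  _-BQO : CountableOrdinal → Set (suc 0ℓ ⊔ c ⊔ ℓ₁ ⊔ ℓ₂)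
  α -BQO = (B : Pred (List ℕ) 0ℓ) → IsBarrier B → OrderType≤ B α →
           (f : Func (members B) Eq.setoid) → Good f

  BQO : Set (suc 0ℓ ⊔ c ⊔ ℓ₁ ⊔ ℓ₂)
  BQO = (α : CountableOrdinal) → α -BQO

{-# OPTIONS --safe #-}
module Submission where

-- An interval order has no 2+2, so comparing right endpoints (x ≼ p iff everything above p is
-- above x) is a total preorder, and wqo makes its strict part ≺ well-founded.  Suppose
-- f : B → P is bad, so that ¬ f s < f t whenever s ◁ t.  By induction along ≺ no restriction of
-- f to an infinite set can have all its values in { x ∣ ¬ p < x }; applied to all of P
-- this is the theorem.  For the induction step let f take its values in S.  The maximal elements
-- of S form a finite antichain, so by the Nash-Williams partition theorem f avoids them on some
-- infinite set.  Fix a member s there.  For each suffix v of s, starting with s itself, there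
-- is a non-maximal p of S such that f t ends no later than p for all members t extending v
-- beyond s: when v = m ∷ v′, any t extending v′ has a predecessor extending v, so ¬ p < f t,
-- and only finitely many values with this property can end later than p.  At v = [] the
-- values lie in { x ∣ ¬ p < x } with p below an element of S, which is a smaller instance.

open import Defs
open import Axiom.ExcludedMiddle using (ExcludedMiddle)
open import Data.Bool.Base using (Bool; true; false)
import Data.Bool.Properties as Bool
open import Data.Empty using (⊥; ⊥-elim)
open import Data.List.Base using (List; []; _∷_; _++_; [_]; map; concat; length)
open import Data.List.Membership.Propositional using (_∈_)
open import Data.List.Membership.Propositional.Properties
  using (∈-++⁺ˡ; ∈-++⁺ʳ; ∈-++⁻; ∈-map⁺; ∈-concat⁺′)
import Data.List.Membership.Setoid as SetoidMembership
open import Data.List.Properties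
  using (length-++; ++-assoc; ++-identityʳ; ++-conicalʳ; ∷-injectiveˡ; ∷-injectiveʳ)
open import Data.List.Relation.Binary.Lex.Strict using (base; this; next)
open import Data.List.Relation.Binary.Subset.Propositional using (_⊆_)
open import Data.List.Relation.Unary.All as All using (All; []; _∷_)
import Data.List.Relation.Unary.All.Properties as All
open import Data.List.Relation.Unary.AllPairs as AllPairs using (AllPairs; []; _∷_)
import Data.List.Relation.Unary.AllPairs.Properties as AllPairs
open import Data.List.Relation.Unary.Any using (here; there)
open import Data.List.Relation.Unary.Linked as Linked using ([-])
open import Data.List.Relation.Unary.Linked.Properties using (Linked⇒AllPairs; AllPairs⇒Linked)
open import Data.Nat.Base as ℕ using (ℕ; zero; suc; z≤n; s≤s; _⊔_)
import Data.Nat.Induction as ℕ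
import Data.Nat.Properties as ℕ
open import Data.Product.Base using (∃; ∃-syntax; _×_; _,_; proj₁; proj₂)
open import Data.Sum.Base as Sum using (_⊎_; inj₁; inj₂)
open import Data.Unit.Base using (⊤; tt)
open import Function.Base using (_∘_; flip; id)
open import Function.Bundles using (_⇔_; mk⇔; Func; _⟨$⟩_)
import Function.Construct.Identity as Identity
open import Induction.WellFounded using (WellFounded; Acc; acc)
open import Level using (Level; Lift; lift; lower; 0ℓ)
open import Relation.Binary.Bundles using (Poset; TotalOrder)
open import Relation.Binary.Core using (Rel)
open import Relation.Binary.Definitions using (Transitive; tri<; tri≈; tri>)
open import Relation.Binary.Morphism.Structures using (IsOrderIsomorphism)
import Relation.Binary.Construct.NonStrictToStrict as NonStrictToStrict
import Relation.Binary.Properties.Poset as PosetProperties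
import Relation.Binary.Properties.TotalOrder as TotalOrderProperties
open import Relation.Binary.PropositionalEquality
  using (_≡_; _≢_; refl; sym; trans; cong; subst; setoid; module ≡-Reasoning)
open import Relation.Nullary.Decidable
  using (Dec; yes; no; does; proof; True; toWitness; fromWitness; decidable-stable)
open import Relation.Nullary.Negation using (¬_)
open import Relation.Nullary.Reflects using (Reflects; invert)
open import Relation.Unary using (Pred) renaming (_⊆_ to _⊆ᴾ_)

private
  variable
    a ℓ r : Level

-- Sequences and unbounded sets of natural numbers

successive⇒later : ∀ {A : Set a} (R : Rel A r) → Transitive R → (g : ℕ → A) →
                   (∀ n → R (g n) (g (suc n))) → ∀ {i j} → i ℕ.< j → R (g i) (g j)
successive⇒later R R-trans g step {i} {suc j} (s≤s i≤j) with ℕ.m≤n⇒m<n∨m≡n i≤j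
... | inj₁ i<j  = R-trans (successive⇒later R R-trans g step i<j) (step j)
... | inj₂ refl = step i

-- The positive form of infinitude: it hands out elements, while `Infinite` only refutes exhausting
-- lists.
Unbounded : Pred ℕ 0ℓ → Set
Unbounded X = ∀ n → ∃[ m ] n ℕ.≤ m × X m

strictlyAbove : ∀ (xs : List ℕ) → ∃[ N ] (∀ {n} → N ℕ.≤ n → All (ℕ._< n) xs)
strictlyAbove []       = 0 , λ _ → []
strictlyAbove (x ∷ xs) with strictlyAbove xs
... | N , above = N ⊔ suc x , λ N≤n →
  ℕ.≤-trans (ℕ.m≤n⊔m N (suc x)) N≤n ∷ above (ℕ.≤-trans (ℕ.m≤m⊔n N (suc x)) N≤n)

unbounded-above : ∀ {X} → Unbounded X → ∀ s →
                  Unbounded (λ n → X n × All (ℕ._< n) s)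
unbounded-above unb s n with strictlyAbove s
... | N , above with unb (n ⊔ N)
...   | m , le , Xm = m , ℕ.≤-trans (ℕ.m≤m⊔n n N) le ,
                      Xm , above (ℕ.≤-trans (ℕ.m≤n⊔m n N) le)

unbounded⇒infinite : ∀ {X} → Unbounded X → Infinite (setoid ℕ) X
unbounded⇒infinite unb (xs , exhausts) with unbounded-above unb xs 0
... | m , _ , Xm , xs<m = ℕ.<-irrefl refl (All.lookup xs<m (exhausts m Xm))

increasing⇒≥ : ∀ (g : ℕ → ℕ) → (∀ n → g n ℕ.< g (suc n)) → ∀ n → n ℕ.≤ g n
increasing⇒≥ g incr zero    = z≤n
increasing⇒≥ g incr (suc n) = ℕ.≤-<-trans (increasing⇒≥ g incr n) (incr n)

-- Increasing lists and initial segments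

pairwise : ∀ {s} → Increasing s → AllPairs ℕ._<_ s
pairwise = Linked⇒AllPairs ℕ.<-trans

increasing-∷ : ∀ {m s} → All (m ℕ.<_) s → Increasing s → Increasing (m ∷ s)
increasing-∷ m<s incr = AllPairs⇒Linked (m<s ∷ pairwise incr)

head< : ∀ {m s} → Increasing (m ∷ s) → All (m ℕ.<_) s
head< incr = AllPairs.head (pairwise incr)

increasing-tail : ∀ {m s} → Increasing (m ∷ s) → Increasing s
increasing-tail incr = AllPairs⇒Linked (AllPairs.tail (pairwise incr))

increasing-++ʳ : ∀ s {u} → Increasing (s ++ u) → Increasing u
increasing-++ʳ []      incr = incr
increasing-++ʳ (x ∷ s) incr = increasing-++ʳ s (increasing-tail incr)

increasing-∷ʳ : ∀ {s i} → Increasing s → All (ℕ._< i) s → Increasing (s ++ [ i ])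
increasing-∷ʳ incr s<i =
  AllPairs⇒Linked (AllPairs.++⁺ (pairwise incr) ([] ∷ []) (All.map (_∷ []) s<i))

increasing-++⇒< : ∀ s {u x y} → Increasing (s ++ u) → x ∈ s → y ∈ u → x ℕ.< y
increasing-++⇒< (x ∷ s) incr (here refl) y∈u = All.lookup (head< incr) (∈-++⁺ʳ s y∈u)
increasing-++⇒< (z ∷ s) incr (there x∈s) y∈u = increasing-++⇒< s (increasing-tail incr) x∈s y∈u

increasing⇒∉ : ∀ s {x u} → Increasing (s ++ x ∷ u) → ¬ x ∈ s
increasing⇒∉ s incr x∈s = ℕ.<-irrefl refl (increasing-++⇒< s incr x∈s (here refl))

initialSegment-tail : ∀ {X x s} → InitialSegmentOf X (x ∷ s) →
                      InitialSegmentOf (λ n → X n × x ℕ.< n) s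
initialSegment-tail (incr , sub , closed) =
    increasing-tail incr
  , (λ n∈s → sub (there n∈s) , All.lookup (head< incr) n∈s)
  , λ { (Xm , x<m) n∈s m<n → drop-head x<m (closed Xm (there n∈s) m<n) }
  where
  drop-head : ∀ {x m s} → x ℕ.< m → m ∈ x ∷ s → m ∈ s
  drop-head x<m (here refl) = ⊥-elim (ℕ.<-irrefl refl x<m)
  drop-head x<m (there m∈s) = m∈s

initialSegment-head≮ : ∀ {X x y s t} → InitialSegmentOf X (x ∷ s) →
                       InitialSegmentOf X (y ∷ t) → ¬ x ℕ.< y
initialSegment-head≮ (_ , sub , _) (incr , _ , closed) x<y
  with closed (sub (here refl)) (here refl) x<y
... | here refl = ℕ.<-irrefl refl x<y
... | there x∈t = ℕ.<-asym x<y (All.lookup (head< incr) x∈t)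

-- Nonempty initial segments of `X` share its least element as head; without it they are initial
-- segments of the rest of `X`.
initialSegments-comparable :
  ∀ {X} s t → InitialSegmentOf X s → InitialSegmentOf X t →
  (∃[ u ] s ≡ t ++ u) ⊎ ProperInitialSegment s t
initialSegments-comparable s       []      _ _ = inj₁ (s , refl)
initialSegments-comparable []      (y ∷ t) _ _ = inj₂ (y , t , refl)
initialSegments-comparable (x ∷ s) (y ∷ t) S T with ℕ.<-cmp x y
... | tri< x<y _ _ = ⊥-elim (initialSegment-head≮ S T x<y)
... | tri> _ _ y<x = ⊥-elim (initialSegment-head≮ T S y<x)
... | tri≈ _ refl _
  with initialSegments-comparable s t (initialSegment-tail S) (initialSegment-tail T)
...   | inj₁ (u , refl)     = inj₁ (u , refl)
...   | inj₂ (z , u , refl) = inj₂ (z , u , refl)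

prefixes-comparable :
  ∀ v s {u x w} → v ++ u ≡ s ++ x ∷ w →
  (∃[ u′ ] s ≡ v ++ u′ × u ≡ u′ ++ x ∷ w) ⊎ ProperInitialSegment s v
prefixes-comparable []      s       eq = inj₁ (s , refl , eq)
prefixes-comparable (y ∷ v) []      eq = inj₂ (y , v , refl)
prefixes-comparable (y ∷ v) (z ∷ s) eq with ∷-injectiveˡ eq
... | refl with prefixes-comparable v s (∷-injectiveʳ eq)
...   | inj₁ (u′ , refl , eq′) = inj₁ (u′ , refl , eq′)
...   | inj₂ (x , w , refl)    = inj₂ (x , w , refl)

increasingBetween : ℕ → ℕ → List (List ℕ)
increasingBetween b zero    = [ [] ]
increasingBetween b (suc k) =
  map (b ∷_) (increasingBetween (suc b) k) ++ increasingBetween (suc b) k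

∈-increasingBetween : ∀ b k {s} → Increasing s → All (b ℕ.≤_) s →
                      All (ℕ._< b ℕ.+ k) s → s ∈ increasingBetween b k
∈-increasingBetween b zero    {[]}    _ _ _ = here refl
∈-increasingBetween b zero    {x ∷ s} _ (b≤x ∷ _) (x<b ∷ _) =
  ⊥-elim (ℕ.<-irrefl refl (ℕ.<-≤-trans (subst (x ℕ.<_) (ℕ.+-identityʳ b) x<b) b≤x))
∈-increasingBetween b (suc k) {[]}    incr [] [] =
  ∈-++⁺ʳ _ (∈-increasingBetween (suc b) k incr [] [])
∈-increasingBetween b (suc k) {x ∷ s} incr (b≤x ∷ b≤s) s<
  with ℕ.m≤n⇒m<n∨m≡n b≤x | subst (λ n → All (ℕ._< n) (x ∷ s)) (ℕ.+-suc b k) s<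
... | inj₂ refl | _ ∷ s<′ =
      ∈-++⁺ˡ (∈-map⁺ (b ∷_) (∈-increasingBetween (suc b) k (increasing-tail incr) (head< incr) s<′))
... | inj₁ b<x  | s<′ =
      ∈-++⁺ʳ _ (∈-increasingBetween (suc b) k incr
                 (b<x ∷ All.map (ℕ.<-trans b<x) (head< incr)) s<′)

-- The singletons and their order type

Singleton : Pred (List ℕ) 0ℓ
Singleton s = ∃[ n ] s ≡ [ n ]

ω : CountableOrdinal
ω = record
  { order       = ℕ.<-strictTotalOrder
  ; wellFounded = ℕ.<-wellFounded
  ; countable   = Identity.injection (setoid ℕ)
  }

singletons≤ω : OrderType≤ Singleton ω
singletons≤ω = record
  { embed  = λ { (_ , n , _) → n }
  ; isMono = record
    { isOrderHomomorphism = record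
      { cong = λ { {_ , _ , refl} {_ , _ , refl} refl → refl }
      ; mono = λ { {_ , _ , refl} {_ , _ , refl} (this m<n) → m<n
                 ; {_ , _ , refl} {_ , _ , refl} (next _ (base ())) }
      }
    ; injective = λ { {_ , _ , refl} {_ , _ , refl} refl → refl }
    ; cancel    = λ { {_ , _ , refl} {_ , _ , refl} m<n → this m<n }
    }
  ; initialSegment = λ {_} {n} _ → ([ n ] , n , refl) , refl
  }

◁-singletons : ∀ {m n} → [ m ] ◁ [ n ] → m ℕ.< n
◁-singletons (_ , incr , (_ , _ , refl) , _ , refl) with head< incr
... | m<n ∷ [] = m<n

-- Dec being Set-valued, excluded middle applied to a Σ-type returns a witness and so serves
-- as a choice operator.

module Classical (em : ∀ {ℓ : Level} → ExcludedMiddle ℓ) where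

  -- Classical principles

  dne : ∀ {A : Set a} → ¬ ¬ A → A
  dne = decidable-stable em

  ¬∀⇒∃¬ : ∀ {A : Set a} {B : Pred A ℓ} → ¬ (∀ x → B x) → ∃[ x ] ¬ B x
  ¬∀⇒∃¬ ¬all = dne λ none → ¬all λ x → dne λ ¬Bx → none (x , ¬Bx)

  -- An inaccessible element has an inaccessible one below it; repeated choice gives an infinite
  -- descent.
  noDescent⇒wellFounded :
    ∀ {A : Set a} {R : Rel A r} →
    (∀ (g : ℕ → A) → ¬ (∀ n → R (g (suc n)) (g n))) → WellFounded R
  noDescent⇒wellFounded {A = A} {R} noDescent x = dne λ ¬acc →
    let walk = walkFrom (x , ¬acc) in
    noDescent (proj₁ ∘ walk) (λ n → proj₁ (proj₂ (descend (walk n))))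
    where
    descend : (y : ∃[ y ] ¬ Acc R y) → ∃[ z ] R z (proj₁ y) × ¬ Acc R z
    descend (y , ¬acc) = dne λ stuck →
      ¬acc (acc λ {z} zRy → dne λ ¬acc′ → stuck (z , zRy , ¬acc′))

    walkFrom : ∃[ y ] ¬ Acc R y → ℕ → ∃[ y ] ¬ Acc R y
    walkFrom y zero    = y
    walkFrom y (suc n) =
      let (z , _ , ¬acc) = descend (walkFrom y n) in z , ¬acc

  -- For reading a proposition back off its colour after a partition.
  decided : ∀ {A : Set a} {b} → does (em {P = A}) ≡ b → Reflects A b
  decided {A = A} refl = proof (em {P = A})

  pigeonhole : (c : ℕ → Bool) → ∃[ b ] (∀ n → ∃[ k ] n ℕ.≤ k × c k ≡ b)
  pigeonhole c with em {P = ∀ n → ∃[ k ] n ℕ.≤ k × c k ≡ true}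
  ... | yes often = true , often
  ... | no  rare  with ¬∀⇒∃¬ rare
  ...   | N , never = false , λ n → n ⊔ N , ℕ.m≤m⊔n n N ,
          Bool.¬-not λ eq → never (n ⊔ N , ℕ.m≤n⊔m n N , eq)

  least : ∀ {X : Pred ℕ ℓ} {n} → X n → ∃[ m ] X m × (∀ {k} → X k → m ℕ.≤ k)
  least {X = X} {n} = go (ℕ.<-wellFounded n)
    where
    go : ∀ {n} → Acc ℕ._<_ n → X n → ∃[ m ] X m × (∀ {k} → X k → m ℕ.≤ k)
    go {n} (acc below) Xn with em {P = ∃[ k ] k ℕ.< n × X k}
    ... | yes (k , k<n , Xk) = go (below k<n) Xk
    ... | no  none = n , Xn , λ {k} Xk → ℕ.≮⇒≥ λ k<n → none (k , k<n , Xk)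

  singletons-isBarrier : IsBarrier Singleton
  singletons-isBarrier = record
    { increasing = λ { (_ , refl) → [-] }
    -- Flattening a list that contains all singletons would exhaust the natural numbers.
    ; infinite   = λ { (xs , exhausts) → unbounded⇒infinite (λ n → n , ℕ.≤-refl , tt)
                         (concat xs , λ n _ → ∈-concat⁺′ (here refl) (exhausts [ n ] (n , refl))) }
    ; antichain  = λ { (m , refl) (n , refl) (s⊆t , t⊈s) → t⊈s (⊇ (s⊆t (here refl))) }
    ; blocks     = λ X infinite _ → block X infinite
    }
    where
    ⊇ : ∀ {m n} → m ∈ [ n ] → [ n ] ⊆ [ m ]
    ⊇ (here refl) = id

    block : ∀ X → Infinite (setoid ℕ) X →
            ∃[ s ] Singleton s × s ≢ [] × InitialSegmentOf X s
    block X infinite with least {X = X}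
      (proj₂ (dne {A = ∃ X} λ empty → infinite ([] , λ n Xn → ⊥-elim (empty (n , Xn)))))
    ... | m , Xm , m≤ = [ m ] , (m , refl) , (λ ()) , [-] , (λ { (here refl) → Xm }) ,
          λ { Xk (here refl) k<m → ⊥-elim (ℕ.<-irrefl refl (ℕ.<-≤-trans k<m (m≤ Xk))) }

  -- Barriers and pairs related by `◁`

  module Barriers {B : Pred (List ℕ) 0ℓ} (isBarrier : IsBarrier B) where
    open IsBarrier isBarrier

    -- The union of the barrier, which is the ground set of `blocks`.
    Support : Pred ℕ 0ℓ
    Support n = ∃[ s ] B s × n ∈ s

    -- If all entries were below `n`, every member would be one of the finitely many increasing
    -- lists below `n`.
    support-unbounded : Unbounded Support
    support-unbounded n = dne λ none →
      infinite (increasingBetween 0 n , λ s Bs →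
        ∈-increasingBetween 0 n (increasing Bs) (All.universal (λ _ → z≤n) s)
          (All.tabulate λ {m} m∈s → ℕ.≰⇒> λ n≤m → none (m , n≤m , s , Bs , m∈s)))

    block : ∀ {Z} → Unbounded Z → Z ⊆ᴾ Support →
            ∃[ s ] B s × s ≢ [] × InitialSegmentOf Z s
    block unb Z⊆ = blocks _ (unbounded⇒infinite unb) Z⊆

    no-member-within : ∀ {s t x} → B s → B t → s ⊆ t → x ∈ t → ¬ ¬ x ∈ s
    no-member-within Bs Bt s⊆t x∈t x∉s = antichain Bs Bt (s⊆t , λ t⊆s → x∉s (t⊆s x∈t))

    no-extension : ∀ {s u} → B s → B (s ++ u) → u ≡ []
    no-extension {s} {[]}    _  _   = refl
    no-extension {s} {x ∷ u} Bs Bsu = ⊥-elim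
      (no-member-within Bs Bsu ∈-++⁺ˡ (∈-++⁺ʳ s (here refl)) (increasing⇒∉ s (increasing Bsu)))

    -- Continue `m ∷ t` by the later elements of `Z` to an infinite set and take its block `s`. Both
    -- lists are initial segments of that set, and `s` cannot extend `m ∷ t`, since it would then
    -- properly contain the member `t`.
    predecessor : ∀ {Z m t} → Unbounded Z → Z ⊆ᴾ Support → B t → Support m →
                  All (m ℕ.<_) t →
                  ∃[ s ] B s × (∃[ x ] ∃[ u ] m ∷ t ≡ s ++ x ∷ u)
    predecessor {Z} {m} {t} unb Z⊆ Bt m∈ m<t with block X-unbounded X⊆
      where
      X : Pred ℕ 0ℓ
      X n = n ∈ m ∷ t ⊎ (Z n × All (ℕ._< n) (m ∷ t))

      X-unbounded : Unbounded X
      X-unbounded n = let (k , n≤k , Xk) = unbounded-above unb (m ∷ t) n in k , n≤k , inj₂ Xk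

      X⊆ : X ⊆ᴾ Support
      X⊆ (inj₁ (here refl)) = m∈
      X⊆ (inj₁ (there n∈t)) = t , Bt , n∈t
      X⊆ (inj₂ (Zn , _))    = Z⊆ Zn
    ... | s , Bs , _ , S with initialSegments-comparable s (m ∷ t) S
          ( increasing-∷ m<t (increasing Bt) , inj₁
          , λ { (inj₁ k∈) _ _ → k∈
              ; (inj₂ (_ , <k)) n∈ k<n → ⊥-elim (ℕ.<-asym k<n (All.lookup <k n∈)) })
    ...   | inj₂ proper     = s , Bs , proper
    ...   | inj₁ (u , refl) = ⊥-elim
            (no-member-within Bt Bs (there ∘ ∈-++⁺ˡ) (here refl)
              λ m∈t → ℕ.<-irrefl refl (All.lookup m<t m∈t))

    predecessor-◁ : ∀ {m s t} → B t → All (m ℕ.<_) t →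
                    (∃[ x ] ∃[ u ] m ∷ t ≡ s ++ x ∷ u) → s ◁ t
    predecessor-◁ Bt m<t proper =
      _ , increasing-∷ m<t (increasing Bt) , proper , _ , refl

    -- Take `t` inside `Z` beyond some `m` in `Z`; the predecessor of `t` through `m` has its
    -- entries in `m ∷ t`, hence in `Z`.
    consecutive-members : ∀ {Z} → Unbounded Z → Z ⊆ᴾ Support →
                          ∃[ s ] ∃[ t ] B s × B t × All Z s × All Z t × s ◁ t
    consecutive-members {Z} Z-unb Z⊆ =
      let (m , _ , Zm)            = Z-unb 0
          (t , Bt , _ , _ , sub , _) = block (unbounded-above Z-unb [ m ]) (Z⊆ ∘ proj₁)
          m<t                     = All.tabulate (All.head ∘ proj₂ ∘ sub)
          Zt                      = All.tabulate (proj₁ ∘ sub)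
          (s , Bs , proper)       = predecessor Z-unb Z⊆ Bt (Z⊆ Zm) m<t
          (_ , _ , m∷t≡)          = proper
      in s , t , Bs , Bt , All.++⁻ˡ s (subst (All Z) m∷t≡ (Zm ∷ Zt)) , Zt
       , predecessor-◁ Bt m<t proper

    -- The well-founded tree of a barrier

    Inside : Pred (List ℕ) 0ℓ
    Inside s = ∃[ p ] ∃[ v ] s ≡ p ++ v × B p

    -- A tree with extensions placed below their parents; a list with a member as prefix is a leaf.
    Child : Rel (List ℕ) 0ℓ
    Child t s = ¬ Inside s × Increasing t × All Support t × (∃[ i ] t ≡ s ++ [ i ])

    -- The union of an infinite branch is an infinite set with the lists of the branch as initial
    -- segments. Its block is a prefix of a long enough one of them, which is then a leaf, yet has a
    -- child.
    child-wellFounded : WellFounded Child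
    child-wellFounded = noDescent⇒wellFounded noBranch
      where
      noBranch : ∀ g → ¬ (∀ n → Child (g (suc n)) (g n))
      noBranch g steps = escape (block X-unbounded X⊆)
        where
        Extends : Rel (List ℕ) 0ℓ
        Extends s t = ∃[ u ] t ≡ s ++ u

        extends-trans : Transitive Extends
        extends-trans {s} (u , refl) (v , refl) = u ++ v , ++-assoc s u v

        label : ℕ → ℕ
        label n = proj₁ (proj₂ (proj₂ (proj₂ (steps n))))

        grows : ∀ n → g (suc n) ≡ g n ++ [ label n ]
        grows n = proj₂ (proj₂ (proj₂ (proj₂ (steps n))))

        incr : ∀ n → Increasing (g (suc n))
        incr n = proj₁ (proj₂ (steps n))

        extends : ∀ {m n} → m ℕ.< n → Extends (g m) (g n)
        extends = successive⇒later Extends extends-trans g (λ n → [ label n ] , grows n)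

        label∈ : ∀ n → label n ∈ g (suc n)
        label∈ n = subst (label n ∈_) (sym (grows n)) (∈-++⁺ʳ (g n) (here refl))

        label-incr : ∀ n → label n ℕ.< label (suc n)
        label-incr n = increasing-++⇒< (g (suc n))
          (subst Increasing (grows (suc n)) (incr (suc n))) (label∈ n) (here refl)

        -- `Child` certifies order and support for the lower list only, hence the shift to
        -- `g (suc n)`.
        X : Pred ℕ 0ℓ
        X k = ∃[ n ] k ∈ g (suc n)

        X-unbounded : Unbounded X
        X-unbounded n = label n , increasing⇒≥ label label-incr n , n , label∈ n

        X⊆ : X ⊆ᴾ Support
        X⊆ (n , k∈) = All.lookup (proj₁ (proj₂ (proj₂ (steps n)))) k∈

        initial : ∀ n → InitialSegmentOf X (g (suc n))
        initial n = incr n , (λ k∈ → n , k∈) , closed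
          where
          closed : ∀ {k j} → X k → j ∈ g (suc n) → k ℕ.< j → k ∈ g (suc n)
          closed (m , k∈) j∈ k<j with ℕ.<-cmp m n
          ... | tri≈ _ refl _ = k∈
          ... | tri< m<n _ _ with extends (s≤s m<n)
          ...   | u , eq = subst (_ ∈_) (sym eq) (∈-++⁺ˡ k∈)
          closed (m , k∈) j∈ k<j | tri> _ _ n<m with extends (s≤s n<m)
          ...   | u , eq with ∈-++⁻ (g (suc n)) (subst (_ ∈_) eq k∈)
          ...     | inj₁ k∈g = k∈g
          ...     | inj₂ k∈u = ⊥-elim (ℕ.<-asym k<j
                      (increasing-++⇒< (g (suc n)) (subst Increasing eq (incr m)) j∈ k∈u))

        length≥ : ∀ n → n ℕ.≤ length (g n)
        length≥ = increasing⇒≥ (length ∘ g) λ n → ℕ.≤-reflexive (sym (begin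
          length (g (suc n))        ≡⟨ cong length (grows n) ⟩
          length (g n ++ [ _ ])     ≡⟨ length-++ (g n) ⟩
          length (g n) ℕ.+ 1        ≡⟨ ℕ.+-comm (length (g n)) 1 ⟩
          suc (length (g n))        ∎))
          where open ≡-Reasoning

        escape : ¬ (∃[ s ] B s × s ≢ [] × InitialSegmentOf X s)
        -- The list at index `suc (length s)` is longer than `s`, so `s` cannot extend it.
        escape (s , Bs , _ , S) with initialSegments-comparable s _ S (initial (length s))
        ... | inj₂ (x , u , eq) = proj₁ (steps (suc (length s))) (s , x ∷ u , eq , Bs)
        ... | inj₁ (u , eq) = ℕ.<-irrefl refl (ℕ.≤-trans (length≥ (suc (length s)))
                (subst (length (g (suc (length s))) ℕ.≤_)
                  (trans (sym (length-++ (g (suc (length s))))) (cong length (sym eq)))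
                  (ℕ.m≤m+n _ (length u))))

    -- The Nash-Williams partition theorem

    module _ (χ : List ℕ → Bool) where

      Homogeneous : List ℕ → Pred ℕ 0ℓ → Bool → Set
      Homogeneous s Z b = ∀ {u} → All Z u → B (s ++ u) → χ (s ++ u) ≡ b

      -- Quantifying over every `Z` lets the property be applied inside sets that are already
      -- thinned.
      Homogenizable : Pred (List ℕ) _
      Homogenizable s = ∀ {Z} → Unbounded Z → Z ⊆ᴾ Support →
                        ∃[ Y ] Unbounded Y × Y ⊆ᴾ Z × ∃ (Homogeneous s Y)

      -- Each label i_n is chosen inside a set homogeneous for all earlier
      -- s ++ [ i_m ], so only the colours attached to the labels themselves remain
      -- to be made equal.
      homogenizable-diagonal :
        ∀ s → ¬ B s → (∀ i → Support i → All (ℕ._< i) s → Homogenizable (s ++ [ i ])) →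
        Homogenizable s
      homogenizable-diagonal s ¬Bs children {Z} Z-unb Z⊆ =
        D , D-unbounded , D⊆Z , colour , homogeneous
        where
        record Stage : Set₁ where
          no-eta-equality
          field
            pool      : Pred ℕ 0ℓ
            unbounded : Unbounded pool
            pool⊆     : pool ⊆ᴾ (λ n → Z n × All (ℕ._< n) s)

          pick : ℕ
          pick = proj₁ (unbounded 0)

          pick∈ : pool pick
          pick∈ = proj₂ (proj₂ (unbounded 0))

        open Stage

        record Refinement (st : Stage) : Set₁ where
          no-eta-equality
          field
            refined   : Stage
            refined⊆  : pool refined ⊆ᴾ (λ n → pool st n × All (ℕ._< n) [ pick st ])
            colour-of : Bool
            uniform   : Homogeneous (s ++ [ pick st ]) (pool refined) colour-of

        open Refinement

        refine : ∀ st → Refinement st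
        refine st
          with children (pick st) (Z⊆ (proj₁ (pool⊆ st (pick∈ st)))) (proj₂ (pool⊆ st (pick∈ st)))
                 (unbounded-above (unbounded st) [ pick st ]) (Z⊆ ∘ proj₁ ∘ pool⊆ st ∘ proj₁)
        ... | Y , Y-unb , Y⊆ , b , hom = record
          { refined   = record { pool = Y ; unbounded = Y-unb ; pool⊆ = pool⊆ st ∘ proj₁ ∘ Y⊆ }
          ; refined⊆  = Y⊆
          ; colour-of = b
          ; uniform   = hom
          }

        stage : ℕ → Stage
        stage zero    = record { pool = _ ; unbounded = unbounded-above Z-unb s ; pool⊆ = id }
        stage (suc n) = refined (refine (stage n))

        label : ℕ → ℕ
        label n = pick (stage n)

        colours : ℕ → Bool
        colours n = colour-of (refine (stage n))

        -- Comparison with the refined pool makes later picks both exceed the pick of `st` and lie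
        -- where its colour is uniform.
        Shrinks : Rel Stage _
        Shrinks st st′ = pool st′ ⊆ᴾ pool (refined (refine st))

        shrinks-trans : Transitive Shrinks
        shrinks-trans {st} {st′} p q = p ∘ proj₁ ∘ refined⊆ (refine st′) ∘ q

        later : ∀ {m n} → m ℕ.< n → Shrinks (stage m) (stage n)
        later = successive⇒later Shrinks
          (λ {st} {st′} {st″} → shrinks-trans {st} {st′} {st″}) stage (λ _ → id)

        label-incr : ∀ {m n} → m ℕ.< n → label m ℕ.< label n
        label-incr {m} {n} m<n = All.head
          (proj₂ (refined⊆ (refine (stage m)) (later {m} m<n (pick∈ (stage n)))))

        colour : Bool
        colour = proj₁ (pigeonhole colours)

        D : Pred ℕ 0ℓ
        D n = ∃[ k ] n ≡ label k × colours k ≡ colour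

        D-unbounded : Unbounded D
        D-unbounded n with proj₂ (pigeonhole colours) n
        ... | k , n≤k , eq = label k ,
              ℕ.≤-trans n≤k (increasing⇒≥ label (λ j → label-incr {j} {suc j} ℕ.≤-refl) k) , k , refl , eq

        D⊆Z : D ⊆ᴾ Z
        D⊆Z (k , refl , _) = proj₁ (pool⊆ (stage k) (pick∈ (stage k)))

        after : ∀ {k n} → D n → label k ℕ.< n → pool (stage (suc k)) n
        after {k} (j , refl , _) lt with ℕ.<-cmp k j
        ... | tri< k<j _ _  = later {k} k<j (pick∈ (stage j))
        ... | tri≈ _ refl _ = ⊥-elim (ℕ.<-irrefl refl lt)
        ... | tri> _ _ j<k  = ⊥-elim (ℕ.<-asym lt (label-incr {j} j<k))

        homogeneous : Homogeneous s D colour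
        homogeneous {[]} _ Bs = ⊥-elim (¬Bs (subst B (++-identityʳ s) Bs))
        -- The first entry after `s` is a label of the chosen colour; the others are later labels,
        -- so they lie in the pool where that colour is uniform.
        homogeneous {x ∷ u} ((k , refl , eq) ∷ Du) Bsu =
          trans (cong χ (sym assoc))
            (trans (uniform (refine (stage k)) u⊆ (subst B (sym assoc) Bsu)) eq)
          where
          assoc : (s ++ [ x ]) ++ u ≡ s ++ x ∷ u
          assoc = ++-assoc s [ x ] u

          u⊆ : All (pool (stage (suc k))) u
          u⊆ = All.tabulate λ y∈ → after {k} (All.lookup Du y∈)
                 (All.lookup (head< (increasing-++ʳ s (increasing Bsu))) y∈)

      -- At a leaf the antichain condition leaves at most `s` itself as a member extending `s`, so
      -- any set is homogeneous. Elsewhere the children are homogenizable by induction.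
      homogenizable : ∀ {s} → Acc Child s → Increasing s → All Support s → Homogenizable s
      homogenizable {s} (acc rs) incr s⊆ {Z} Z-unb Z⊆ with em {P = Inside s}
      ... | yes (p , v , refl , Bp) = Z , Z-unb , id , χ s , λ {u} _ Bsu →
              cong χ (trans (cong (s ++_) (++-conicalʳ v u
                (no-extension Bp (subst B (++-assoc p v u) Bsu)))) (++-identityʳ s))
      ... | no outside = homogenizable-diagonal s
              (λ Bs → outside (s , [] , sym (++-identityʳ s) , Bs))
              (λ i i∈ s<i → homogenizable
                (rs (outside , increasing-∷ʳ incr s<i , All.++⁺ s⊆ (i∈ ∷ []) , i , refl))
                (increasing-∷ʳ incr s<i) (All.++⁺ s⊆ (i∈ ∷ [])))
              Z-unb Z⊆

      -- The case of the root: every member extends the empty list.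
      nashWilliams : ∀ {Z} → Unbounded Z → Z ⊆ᴾ Support →
                     ∃[ Y ] Unbounded Y × Y ⊆ᴾ Z × (∃[ b ] (∀ {t} → B t → All Y t → χ t ≡ b))
      nashWilliams Z-unb Z⊆ =
        let (Y , Y-unb , Y⊆ , b , hom) =
              homogenizable (child-wellFounded []) Linked.[] [] Z-unb Z⊆
        in Y , Y-unb , Y⊆ , b , λ Bt Yt → hom Yt Bt

  -- Well-quasi-orders and bad sequences

  module WellQuasiOrder {c ℓ₁ ℓ₂} (P : Poset c ℓ₁ ℓ₂) where
    open Poset P renaming (refl to ≤-refl; trans to ≤-trans)
    open PosetProperties P using (_<_; <-respˡ-≈; ≤∧≉⇒<)
    open SetoidMembership Eq.setoid using () renaming (_∈_ to _∈ₛ_)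

    Bad : (ℕ → Carrier) → Set _
    Bad g = ∀ {i j} → i ℕ.< j → ¬ g i ≤ g j

    -- A bad sequence takes each value at most once, since equal values are comparable.
    bad-eventually∉ : ∀ {g} → Bad g → ∀ xs → ∃[ N ] (∀ {n} → N ℕ.≤ n → ¬ g n ∈ₛ xs)
    bad-eventually∉ bad [] = 0 , λ _ ()
    bad-eventually∉ {g} bad (x ∷ xs) with bad-eventually∉ bad xs | em {P = ∃[ i ] g i ≈ x}
    ... | N , beyond | no none = N , λ where
          N≤n (here gn≈x) → none (_ , gn≈x)
          N≤n (there gn∈) → beyond N≤n gn∈
    ... | N , beyond | yes (i , gi≈x) = N ⊔ suc i , λ where
          N≤n (here gn≈x) → bad (ℕ.≤-trans (ℕ.m≤n⊔m N (suc i)) N≤n)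
                                (reflexive (Eq.trans gi≈x (Eq.sym gn≈x)))
          N≤n (there gn∈) → beyond (ℕ.≤-trans (ℕ.m≤m⊔n N (suc i)) N≤n) gn∈

    -- Call an index terminal if no later value lies below its own. By badness a later value that is
    -- below is strictly below, so well-foundedness yields terminal indices arbitrarily far out;
    -- their values form an infinite antichain.
    no-bad-sequence : WQO preorder → ∀ {g} → ¬ Bad g
    no-bad-sequence (wf , no-antichain) {g} bad =
      no-antichain (A , A-antichain , A-infinite)
      where
      Terminal : Pred ℕ _
      Terminal i = ∀ {j} → i ℕ.< j → ¬ g j ≤ g i

      terminal-above : ∀ n → Acc (_⋦_ preorder) (g n) → ∃[ i ] n ℕ.≤ i × Terminal i
      terminal-above n (acc rs) with em {P = ∃[ j ] n ℕ.< j × g j ≤ g n}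
      ... | no none = n , ℕ.≤-refl , λ n<j gj≤gn → none (_ , n<j , gj≤gn)
      ... | yes (j , n<j , gj≤gn) with terminal-above j (rs (gj≤gn , bad n<j))
      ...   | i , j≤i , terminal = i , ℕ.≤-trans (ℕ.<⇒≤ n<j) j≤i , terminal

      A : Pred Carrier _
      A x = Lift c (∃[ i ] Terminal i × x ≈ g i)

      A-antichain : Antichain preorder A
      A-antichain (lift (i , i-term , x≈)) (lift (j , j-term , y≈)) x≉y x≤y with ℕ.<-cmp i j
      ... | tri< i<j _ _  = bad i<j (≤-respˡ-≈ x≈ (≤-respʳ-≈ y≈ x≤y))
      ... | tri≈ _ refl _ = x≉y (Eq.trans x≈ (Eq.sym y≈))
      ... | tri> _ _ j<i  = j-term j<i (≤-respˡ-≈ x≈ (≤-respʳ-≈ y≈ x≤y))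

      A-infinite : Infinite Eq.setoid A
      A-infinite (xs , exhausts) with bad-eventually∉ bad xs
      ... | N , beyond with terminal-above N (wf (g N))
      ...   | i , N≤i , i-term = beyond N≤i (exhausts (g i) (lift (i , i-term , Eq.refl)))

    -- `WQO` speaks of subsets in one fixed universe. Replacing `A x` by the truth of its decision
    -- moves `A` there from any universe.
    finite-antichain : WQO preorder → ∀ {A : Pred Carrier a} → Antichain preorder A →
                       ∃[ xs ] (∀ x → A x → x ∈ₛ xs)
    finite-antichain (_ , no-antichain) {A = A} antichain =
      let (xs , exhausts) = dne λ infinite → no-antichain
            ( (λ x → Lift (c Level.⊔ ℓ₁ Level.⊔ ℓ₂) (True (em {P = A x})))
            , (λ x∈ y∈ → antichain (toWitness (lower x∈)) (toWitness (lower y∈)))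
            , infinite)
      in xs , λ x Ax → exhausts x (lift (fromWitness Ax))

    -- A sequence is a map on the barrier of singletons, of type ω, where `◁` implies `<` on the
    -- entries.
    bqo⇒no-bad-sequence : BQO preorder → ∀ {g} → ¬ Bad g
    bqo⇒no-bad-sequence bqo {g} bad
      with bqo ω Singleton singletons-isBarrier singletons≤ω
             (record { to = λ { (_ , n , _) → g n }
                     ; cong = λ { {_ , _ , refl} {_ , _ , refl} refl → Eq.refl } })
    ... | (_ , _ , refl) , (_ , _ , refl) , s◁t , gm≤gn = bad (◁-singletons s◁t) gm≤gn

    -- Infinite descents and injective sequences in an antichain are both bad sequences.
    bqo⇒wqo : BQO preorder → WQO preorder
    bqo⇒wqo bqo = wellFounded , no-infinite-antichain
      where
      ⋧-trans : Transitive (flip (_⋦_ preorder))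
      ⋧-trans (y≤x , x≰y) (z≤y , _) = ≤-trans z≤y y≤x , λ x≤z → x≰y (≤-trans x≤z z≤y)

      wellFounded : WellFounded (_⋦_ preorder)
      wellFounded = noDescent⇒wellFounded λ g descends →
        bqo⇒no-bad-sequence bqo {g} λ i<j →
          proj₂ (successive⇒later (flip (_⋦_ preorder)) ⋧-trans g descends i<j)

      no-infinite-antichain : ¬ (∃[ A ] Antichain preorder A × Infinite Eq.setoid A)
      no-infinite-antichain (A , antichain , infinite) = bqo⇒no-bad-sequence bqo {g} λ {i} {j} i<j →
        antichain (proj₁ (proj₂ (fresh (seen i)))) (proj₁ (proj₂ (fresh (seen j))))
          λ gi≈gj → proj₂ (proj₂ (fresh (seen j)))
            (successive⇒later (λ s t → (proj₁ (fresh s) ∷ s) ⊆ₗ t) (λ p q → q ∘ there ∘ p)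
              seen (λ _ → id) i<j (here (Eq.sym gi≈gj)))
        where
        _⊆ₗ_ : Rel (List Carrier) _
        s ⊆ₗ t = ∀ {x} → x ∈ₛ s → x ∈ₛ t

        fresh : ∀ xs → ∃[ x ] A x × ¬ x ∈ₛ xs
        fresh xs = dne λ none → infinite
          (xs , λ x Ax → dne λ x∉ → none (x , Ax , x∉))

        -- All earlier choices are kept, so that each new one differs from every one of them.
        seen : ℕ → List Carrier
        seen zero    = []
        seen (suc n) = proj₁ (fresh (seen n)) ∷ seen n

        g : ℕ → Carrier
        g n = proj₁ (fresh (seen n))

    -- Comparison of right endpoints

    module IntervalOrder
      (2+2-free : ∀ {a b c d} → a < b → c < d → a < d ⊎ c < b)
      (wqo : WQO preorder)
      where

      <-≤-trans : ∀ {x y z} → x < y → y ≤ z → x < z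
      <-≤-trans = NonStrictToStrict.<-≤-trans _≈_ _≤_ Eq.sym ≤-trans antisym ≤-respʳ-≈

      infix 4 _≼_ _≺_

      _≼_ : Rel Carrier _
      x ≼ p = ∀ {y} → p < y → x < y

      _≺_ : Rel Carrier _
      p ≺ q = ∃[ y ] p < y × ¬ q < y

      -- Witnesses against both comparisons would form a 2+2.
      ≼-total : ∀ x y → x ≼ y ⊎ y ≼ x
      ≼-total x y with em {P = ∃[ z ] y < z × ¬ x < z}
      ... | no none = inj₁ λ y<z → dne λ x≮z → none (_ , y<z , x≮z)
      ... | yes (z , y<z , x≮z) = inj₂ λ x<w → Sum.[ id , ⊥-elim ∘ x≮z ] (2+2-free y<z x<w)

      ≺-trans : Transitive (flip _≺_)
      ≺-trans (y , q<y , r≮y) (z , p<z , q≮z) with 2+2-free p<z q<y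
      ... | inj₁ p<y = y , p<y , r≮y
      ... | inj₂ q<z = ⊥-elim (q≮z q<z)

      ≺⇒≼ : ∀ {p q} → p ≺ q → p ≼ q
      ≺⇒≼ (y , p<y , q≮y) q<z = Sum.[ id , ⊥-elim ∘ q≮y ] (2+2-free p<y q<z)

      -- The witnesses `y` of the steps of a descent form a bad sequence: if `yi ≤ yj` with `i < j`,
      -- then `g (suc i)` is below `yj`, and so is `g j`, which ends no later; but `yj` was chosen
      -- not above `g j`.
      ≺-wellFounded : WellFounded _≺_
      ≺-wellFounded = noDescent⇒wellFounded noDescent
        where
        noDescent : ∀ g → ¬ (∀ n → g (suc n) ≺ g n)
        noDescent g descends = no-bad-sequence wqo {λ n → proj₁ (descends n)} bad
          where
          ≼-later : ∀ {i j} → suc i ℕ.≤ j → g j ≼ g (suc i)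
          ≼-later i<j with ℕ.m≤n⇒m<n∨m≡n i<j
          ... | inj₁ si<j = ≺⇒≼ (successive⇒later (flip _≺_) ≺-trans g descends si<j)
          ... | inj₂ refl = id

          bad : Bad (λ n → proj₁ (descends n))
          bad {i} {j} i<j yi≤yj = proj₂ (proj₂ (descends j)) (≼-later i<j
            (<-≤-trans (proj₁ (proj₂ (descends i))) yi≤yj))

      module _ (S : Pred Carrier a) where

        NonMaximal : Pred Carrier _
        NonMaximal x = ∃[ y ] S y × x < y

        -- A maximum for the total preorder `≼`, seeded with `p` so that it is attained at a
        -- non-maximal element.
        latest-end : ∀ xs {p} → NonMaximal p →
                     ∃[ q ] NonMaximal q × p ≼ q × (∀ {x} → NonMaximal x → x ∈ₛ xs → x ≼ q)
        latest-end []       {p} p-nm = p , p-nm , id , λ _ ()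
        latest-end (e ∷ xs) {p} p-nm with latest-end xs p-nm | em {P = NonMaximal e}
        ... | q , q-nm , p≼q , xs≼q | no e-max = q , q-nm , p≼q , λ where
                (y , Sy , x<y) (here x≈e) → ⊥-elim (e-max (y , Sy , <-respˡ-≈ x≈e x<y))
                x-nm (there x∈)           → xs≼q x-nm x∈
        ... | q , q-nm , p≼q , xs≼q | yes e-nm with ≼-total e q
        ...   | inj₁ e≼q = q , q-nm , p≼q , λ where
                _    (here x≈e) q<y → <-respˡ-≈ (Eq.sym x≈e) (e≼q q<y)
                x-nm (there x∈)     → xs≼q x-nm x∈
        ...   | inj₂ q≼e = e , e-nm , p≼q ∘ q≼e , λ where
                _    (here x≈e) e<y → <-respˡ-≈ (Eq.sym x≈e) e<y
                x-nm (there x∈)     → xs≼q x-nm x∈ ∘ q≼e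

        -- Only the maximal elements of { x ∈ S ∣ ¬ p < x } can end later than p, and
        -- they form a finite antichain.
        uniform-end : ∀ {p} → NonMaximal p →
                      ∃[ q ] NonMaximal q × (∀ {x} → S x → NonMaximal x → ¬ p < x → x ≼ q)
        uniform-end {p} p-nm =
          let (xs , exhausts) = finite-antichain wqo {A = Late}
                (λ where (_ , _ , max) (Sy , p≮y , _) x≉y x≤y → max Sy p≮y (≤∧≉⇒< x≤y x≉y))
              (q , q-nm , p≼q , xs≼q) = latest-end xs p-nm
          in q , q-nm , λ Sx x-nm p≮x → late-or-earlier p≼q (xs≼q x-nm ∘ exhausts _) Sx p≮x em
          where
          Late : Pred Carrier _
          Late x = S x × ¬ p < x × (∀ {z} → S z → ¬ p < z → ¬ x < z)

          late-or-earlier : ∀ {q x} → p ≼ q → (Late x → x ≼ q) → S x → ¬ p < x →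
                            Dec (∃[ z ] S z × ¬ p < z × x < z) → x ≼ q
          -- Since `z` is above `x` but not above `p`, already `p` ends no earlier than `x`.
          late-or-earlier p≼q late Sx p≮x (yes (z , _ , p≮z , x<z)) q<y =
            Sum.[ id , ⊥-elim ∘ p≮z ] (2+2-free x<z (p≼q q<y))
          late-or-earlier p≼q late Sx p≮x (no none) =
            late (Sx , p≮x , λ Sz p≮z x<z → none (_ , Sz , p≮z , x<z))

      -- Bad arrays on a barrier

      module BadArray {B} (isBarrier : IsBarrier B) (f : Func (members B) Eq.setoid)
                      (bad : ¬ Good preorder f) where
        open IsBarrier isBarrier using (increasing)
        open Barriers isBarrier

        Into : Pred Carrier a → Pred ℕ 0ℓ → Set a
        Into S Z = ∀ {t} (Bt : B t) → All Z t → S (f ⟨$⟩ (t , Bt))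

        -- Consecutive members with equal values would make `f` good. The membership proof is
        -- existential because colourings live on bare lists.
        not-constant : ∀ {e Z} → Unbounded Z → Z ⊆ᴾ Support →
                       ¬ (∀ {t} → B t → All Z t → ∃[ Bt ] f ⟨$⟩ (t , Bt) ≈ e)
        not-constant Z-unb Z⊆ const =
          let (s , t , Bs , Bt , Zs , Zt , s◁t) = consecutive-members Z-unb Z⊆
              (Bs′ , fs≈e) = const Bs Zs
              (Bt′ , ft≈e) = const Bt Zt
          in bad ((s , Bs′) , (t , Bt′) , s◁t , reflexive (Eq.trans fs≈e (Eq.sym ft≈e)))

        -- Colour members by whether they take the value `e`; a homogeneous set of the positive
        -- colour would make `f` constant.
        avoid-value : ∀ e {Z} → Unbounded Z → Z ⊆ᴾ Support →
                      ∃[ Y ] Unbounded Y × Y ⊆ᴾ Z × Into (λ x → ¬ x ≈ e) Y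
        avoid-value e {Z} Z-unb Z⊆ =
          avoid (nashWilliams (λ t → does (em {P = HasValue t})) Z-unb Z⊆)
          where
          HasValue : Pred (List ℕ) _
          HasValue t = ∃[ Bt ] f ⟨$⟩ (t , Bt) ≈ e

          avoid : ∃[ Y ] Unbounded Y × Y ⊆ᴾ Z ×
                    (∃[ b ] (∀ {t} → B t → All Y t → does (em {P = HasValue t}) ≡ b)) →
                  ∃[ Y ] Unbounded Y × Y ⊆ᴾ Z × Into (λ x → ¬ x ≈ e) Y
          avoid (Y , Y-unb , Y⊆ , false , uniform) =
            Y , Y-unb , Y⊆ , λ Bt Yt ft≈e → invert (decided (uniform Bt Yt)) (Bt , ft≈e)
          avoid (Y , Y-unb , Y⊆ , true , uniform) =
            ⊥-elim (not-constant Y-unb (Z⊆ ∘ Y⊆) λ Bt Yt → invert (decided (uniform Bt Yt)))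

        avoid-values : ∀ xs {Z} → Unbounded Z → Z ⊆ᴾ Support →
                       ∃[ Y ] Unbounded Y × Y ⊆ᴾ Z × Into (λ x → ¬ x ∈ₛ xs) Y
        avoid-values []       Z-unb Z⊆ = _ , Z-unb , id , λ _ _ ()
        avoid-values (e ∷ xs) Z-unb Z⊆ =
          let (Y , Y-unb , Y⊆ , ≉e)  = avoid-value e Z-unb Z⊆
              (X , X-unb , X⊆ , ∉xs) = avoid-values xs Y-unb (Z⊆ ∘ Y⊆)
          in X , X-unb , Y⊆ ∘ X⊆ , λ where
               Bt Xt (here ft≈e)   → ≉e Bt (All.map X⊆ Xt) ft≈e
               Bt Xt (there ft∈xs) → ∉xs Bt Xt ft∈xs

        module Suffixes (S : Pred Carrier a) {Y} (Y-unb : Unbounded Y) (Y⊆ : Y ⊆ᴾ Support)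
                        (into : Into (λ x → S x × NonMaximal S x) Y)
                        {s} (Bs : B s) (Ys : All Y s) where

          -- Bounded below by all of `s`, not just the current suffix, so that one set serves the
          -- whole descent.
          Beyond : Pred ℕ 0ℓ
          Beyond n = Y n × All (ℕ._< n) s

          Beyond-unb : Unbounded Beyond
          Beyond-unb = unbounded-above Y-unb s

          EndsBy : List ℕ → Carrier → Set _
          EndsBy v p = ∀ {u} → All Beyond u → (Bt : B (v ++ u)) → f ⟨$⟩ (v ++ u , Bt) ≼ p

          StartsBeforeEnd : List ℕ → Carrier → Set _
          StartsBeforeEnd v p =
            ∀ {u} → All Beyond u → (Bt : B (v ++ u)) → ¬ p < f ⟨$⟩ (v ++ u , Bt)

          -- Take the predecessor of `v ++ u` through `m`. If it extends `m ∷ v`, its value ends by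
          -- `p`, so `p` below the value at `v ++ u` would contradict badness. Otherwise it is a
          -- proper prefix of `m ∷ v`, hence properly contained in the member `s`.
          endsBy⇒startsBeforeEnd : ∀ q m v {p} → q ++ m ∷ v ≡ s →
                                   EndsBy (m ∷ v) p → StartsBeforeEnd v p
          endsBy⇒startsBeforeEnd q m v refl ends {u} u⊆ Bt p<ft =
            contradict (predecessor Y-unb Y⊆ Bt (s , Bs , m∈s) m<)
            where
            m∈s : m ∈ s
            m∈s = ∈-++⁺ʳ q (here refl)

            m∷v-incr : Increasing (m ∷ v)
            m∷v-incr = increasing-++ʳ q (increasing Bs)

            m< : All (m ℕ.<_) (v ++ u)
            m< = All.++⁺ (head< m∷v-incr) (All.map (λ (_ , s<n) → All.lookup s<n m∈s) u⊆)

            contradict : ¬ (∃[ t ] B t × (∃[ x ] ∃[ w ] m ∷ v ++ u ≡ t ++ x ∷ w))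
            contradict (t , Bt′ , proper@(_ , _ , eq)) with prefixes-comparable (m ∷ v) t eq
            ... | inj₁ (u′ , refl , refl) = bad
                  ( (t , Bt′) , (_ , Bt) , predecessor-◁ {s = m ∷ v ++ u′} Bt m< proper
                  , proj₁ (ends (All.++⁻ˡ u′ u⊆) Bt′ p<ft) )
            ... | inj₂ (y , _ , m∷v≡) = no-member-within Bt′ Bs
                  (λ n∈t → ∈-++⁺ʳ q (subst (_ ∈_) (sym m∷v≡) (∈-++⁺ˡ n∈t)))
                  (∈-++⁺ʳ q (subst (y ∈_) (sym m∷v≡) (∈-++⁺ʳ t (here refl))))
                  (increasing⇒∉ t (subst Increasing m∷v≡ m∷v-incr))

          -- Each entry removed turns an end bound into a start bound, which `uniform-end` turns
          -- back into an end bound. After the last entry the start bound is kept, as the induction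
          -- asks for.
          descend : ∀ q m v {p} → q ++ m ∷ v ≡ s → NonMaximal S p → EndsBy (m ∷ v) p →
                    ∃[ p′ ] NonMaximal S p′ × StartsBeforeEnd [] p′
          descend q m []       {p} eq p-nm ends = p , p-nm , endsBy⇒startsBeforeEnd q m [] eq ends
          descend q m (n ∷ v) eq p-nm ends with uniform-end S p-nm
          ... | p′ , p′-nm , ≼p′ =
                descend (q ++ [ m ]) n v (trans (++-assoc q [ m ] (n ∷ v)) eq) p′-nm λ u⊆ Bt →
                  let (St , t-nm) = into Bt (All.++⁺ (suffix⊆ eq) (All.map proj₁ u⊆))
                  in ≼p′ St t-nm (endsBy⇒startsBeforeEnd q m (n ∷ v) eq ends u⊆ Bt)
            where
            suffix⊆ : q ++ m ∷ n ∷ v ≡ s → All Y (n ∷ v)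
            suffix⊆ refl = All.tail (All.++⁻ʳ q Ys)

          -- The only member extending `s` is `s`.
          endsBy-self : EndsBy s (f ⟨$⟩ (s , Bs))
          endsBy-self {u} u⊆ Bt f<y with no-extension Bs Bt
          ... | refl = <-respˡ-≈ (Func.cong f (sym (++-identityʳ s))) f<y

        -- The induction hypothesis is an argument, so that one proof covers both the induction step
        -- and the final application to all of P.
        not-into : ∀ (S : Pred Carrier a) →
                   (∀ {p} → NonMaximal S p → ∀ {Z} → Unbounded Z → Z ⊆ᴾ Support →
                            ¬ Into (λ x → ¬ p < x) Z) →
                   ∀ {Z} → Unbounded Z → Z ⊆ᴾ Support → ¬ Into S Z
        not-into S smaller {Z} Z-unb Z⊆ into =
          let (xs , exhausts) = finite-antichain wqo
                {A = λ x → S x × (∀ {y} → S y → ¬ x < y)}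
                (λ where (_ , max) (Sy , _) x≉y x≤y → max Sy (≤∧≉⇒< x≤y x≉y))
              (Y , Y-unb , Y⊆ , ∉xs) = avoid-values xs Z-unb Z⊆
              intoʸ : Into (λ x → S x × NonMaximal S x) Y
              intoʸ = λ Bt Yt → let St = into Bt (All.map Y⊆ Yt) in
                St , dne λ max → ∉xs Bt Yt (exhausts _ (St , λ Sy x<y → max (_ , Sy , x<y)))
              (s , Bs , s≢[] , _ , s⊆ , _) = block Y-unb (Z⊆ ∘ Y⊆)
          in finish Y-unb (Z⊆ ∘ Y⊆) intoʸ s Bs s≢[] (All.tabulate s⊆)
          where
          finish : ∀ {Y} → Unbounded Y → Y ⊆ᴾ Support → Into (λ x → S x × NonMaximal S x) Y →
                   ∀ s → B s → s ≢ [] → ¬ All Y s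
          finish Y-unb Y⊆ intoʸ []      Bs s≢[] Ys = s≢[] refl
          finish Y-unb Y⊆ intoʸ (m ∷ v) Bs _    Ys =
            let open Suffixes S Y-unb Y⊆ intoʸ Bs Ys
                (p , p-nm , starts) = descend [] m v refl (proj₂ (intoʸ Bs Ys)) endsBy-self
            in smaller p-nm Beyond-unb (Y⊆ ∘ proj₁) λ Bt t⊆ → starts t⊆ Bt

        -- If `q` is non-maximal among the elements not above `p`, the element above it witnesses
        -- `q ≺ p`.
        not-into-start-before : ∀ {p} → Acc _≺_ p → ∀ {Z} → Unbounded Z → Z ⊆ᴾ Support →
                                ¬ Into (λ x → ¬ p < x) Z
        not-into-start-before (acc rs) = not-into _
          λ (y , p≮y , q<y) → not-into-start-before (rs (y , q<y , p≮y))

        absurd : ⊥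
        absurd = not-into (λ _ → ⊤) (λ _ → not-into-start-before (≺-wellFounded _))
                   support-unbounded id (λ _ _ → tt)

      bqo : BQO preorder
      bqo α B isBarrier _ f = dne (BadArray.absurd isBarrier f)

-- Interval orders contain no 2+2

2+2-free : (∀ {ℓ : Level} → ExcludedMiddle ℓ) →
           ∀ {c ℓ₁ ℓ₂ κ : Level} (P : Poset c ℓ₁ ℓ₂) → IsIntervalOrder κ P →
           let open PosetProperties P using (_<_) in
           ∀ {a b c d} → a < b → c < d → a < d ⊎ c < b
2+2-free em P isIntervalOrder {a} {b} {c} {d} a<b c<d = split em
  where
  open IsIntervalOrder isIntervalOrder
  open IsOrderIsomorphism isIso using (mono; cancel)
  open TotalOrder chain using (_≤_; total; reflexive; antisym; module Eq)
    renaming (trans to ≤-trans; ≤-respʳ-≈ to ≤-respʳ)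
  open TotalOrderProperties chain using () renaming (_<_ to _<ᶜ_)
  open PosetProperties P using (_<_)

  _∈ᴵ_ : _ → Poset.Carrier P → Set _
  x ∈ᴵ a = NonemptyInterval.points (proj₁ (rep a)) x

  split : Dec (∃[ x ] ∃[ w ] x ∈ᴵ a × w ∈ᴵ d × ¬ x <ᶜ w) → a < d ⊎ c < b
  split (no none) = inj₁ (cancel λ x∈a w∈d →
    decidable-stable em λ x≮w → none (_ , _ , x∈a , w∈d , x≮w))
  -- Here `w ≤ x`, so any `u` in `c` and `v` in `b` satisfy `u < w ≤ x < v`.
  split (yes (x , w , x∈a , w∈d , x≮w)) = inj₂ (cancel λ u∈c v∈b →
    <-trans (<-≤-trans (mono c<d u∈c w∈d) (≮⇒≥ x≮w)) (mono a<b x∈a v∈b))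
    where
    open TotalOrderProperties chain using (<-trans)

    <-≤-trans : ∀ {x y z} → x <ᶜ y → y ≤ z → x <ᶜ z
    <-≤-trans = NonStrictToStrict.<-≤-trans _ _≤_ Eq.sym ≤-trans antisym ≤-respʳ

    ≮⇒≥ : ∀ {x y} → ¬ x <ᶜ y → y ≤ x
    ≮⇒≥ {x} {y} x≮y = NonStrictToStrict.≮⇒≥ _ _≤_ Eq.sym (λ _ _ → em) reflexive total x≮y

theorem1p6 : (∀ {ℓ : Level} → ExcludedMiddle ℓ) →
    ∀ {c ℓ₁ ℓ₂ κ : Level} (P : Poset c ℓ₁ ℓ₂) → IsIntervalOrder κ P →
    BQO (Poset.preorder P) ⇔ WQO (Poset.preorder P)
theorem1p6 em P isIntervalOrder =
  mk⇔ bqo⇒wqo (IntervalOrder.bqo (2+2-free em P isIntervalOrder))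
  where open Classical.WellQuasiOrder em P
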